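{- There is an absolute constant $c$ such that for every positive integer $n$ and every out-directed tree $T$ on $m$ vertices, $$\mathrm{R}(\vec{P}_n,T)\le c(n+m).$$
   Context: $\vec{P}_n$ denotes the directed path on $n$ vertices. An out-directed tree is an oriented tree (underlying graph a tree, no bidirected edges) with a vertex $r$ such that all edges are directed away from $r$. $\mathrm{R}(G_1,G_2)$ is the least $N$ such that every red/blue colouring of the edges of the complete directed graph $\overleftrightarrow{K}_N$ (edge $xy$ for every ordered pair of distinct vertices) contains a red copy of $G_1$ or a blue copy of $G_2$. -}

module Defs where

open import Data.Fin.Base using (Fin; zero; suc; toℕ; fromℕ; inject₁)
open import Data.Nat.Base using (ℕ; suc; _≤_)
open import Data.Nat.Properties using (_≟_; 1+n≢n)
open import Data.Product.Base using (Σ-syntax; _×_)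
open import Data.Sum.Base using (_⊎_)
open import Function.Definitions using (Injective)
open import Level using (0ℓ)
open import Relation.Binary.Construct.Closure.ReflexiveTransitive using (Star)
open import Relation.Binary.Construct.Closure.Symmetric using (SymClosure)
open import Relation.Binary.Core using (Rel)
open import Relation.Binary.Definitions using (Decidable)
open import Relation.Binary.PropositionalEquality.Core using (_≡_)
open import Relation.Nullary.Negation.Core using (¬_)

-- Decidability is part of the data: constructively, this is what makes the
-- edge set of a finite digraph finite.
record Digraph (n : ℕ) : Set₁ where
  field
    _⟶_      : Rel (Fin n) 0ℓ
    _⟶?_     : Decidable _⟶_
    loopless : ∀ x → ¬ (x ⟶ x)

P⃗ : ∀ n → Digraph n
P⃗ n = record
  { _⟶_      = λ i j → suc (toℕ i) ≡ toℕ j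
  ; _⟶?_     = λ i j → suc (toℕ i) ≟ toℕ j
  ; loopless = λ _ → 1+n≢n
  }

module _ {n : ℕ} (_∼_ : Rel (Fin n) 0ℓ) where

  IsPath : ∀ {k} → (Fin (suc k) → Fin n) → Set
  IsPath {k} v = Injective _≡_ _≡_ v × (∀ (i : Fin k) → v (inject₁ i) ∼ v (suc i))

  Connected : Set
  Connected = ∀ x y → Star _∼_ x y

  -- A cycle has at least three vertices, hence 2 ≤ k.
  Acyclic : Set
  Acyclic = ∀ {k} (v : Fin (suc k) → Fin n) → 2 ≤ k → IsPath v →
            ¬ (v (fromℕ k) ∼ v zero)

module _ {m : ℕ} (T : Digraph m) where
  open Digraph T

  Underlying : Rel (Fin m) 0ℓ
  Underlying = SymClosure _⟶_

  -- Every path of the underlying graph that starts at r is traversed in the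
  -- direction of its edges.
  DirectedAwayFrom : Fin m → Set
  DirectedAwayFrom r =
    ∀ {k} (v : Fin (suc k) → Fin m) → v zero ≡ r → IsPath Underlying v →
    ∀ (i : Fin k) → v (inject₁ i) ⟶ v (suc i)

  record IsOutDirectedTree : Set where
    field
      oriented         : ∀ {x y} → x ⟶ y → ¬ (y ⟶ x)
      connected        : Connected Underlying
      acyclic          : Acyclic Underlying
      root             : Fin m
      directedAwayFrom : DirectedAwayFrom root

data Colour : Set where
  red blue : Colour

-- The edges of the complete digraph are the ordered pairs of distinct
-- vertices.  Values on the diagonal are junk: they are never inspected by
-- Copy, since a copy is injective and a Digraph has no loops.
EdgeColouring : ℕ → Set
EdgeColouring N = Fin N → Fin N → Colour

Copy : ∀ {N n} → Colour → Digraph n → EdgeColouring N → Set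
Copy {N} {n} c G χ =
  Σ[ f ∈ (Fin n → Fin N) ]
    Injective _≡_ _≡_ f × (∀ x y → x ⟶ y → χ (f x) (f y) ≡ c)
  where open Digraph G

module _ {n₁ n₂ : ℕ} (G₁ : Digraph n₁) (G₂ : Digraph n₂) where

  Arrows : ℕ → Set
  Arrows N = ∀ (χ : EdgeColouring N) → Copy red G₁ χ ⊎ Copy blue G₂ χ

  -- N = R(G₁ , G₂).  A predicate rather than a function, because for
  -- arbitrary digraphs there need not be such an N.
  IsRamseyNumber : ℕ → Set
  IsRamseyNumber N = Arrows N × (∀ M → Arrows M → N ≤ M)

{-# OPTIONS --safe #-}
-- Remove a longest red path P from the colouring.  If the rest contains a red
-- path W = w₁ … w_d, let π_s be a longest red path that consists of a prefix of
-- P and a segment of W ending in w_s, and let x_s be the vertex of P in position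
-- |π_s|.  The positions increase with s, and since P cannot be lengthened, all
-- edges w_t → x_s and x_t → w_s with s ≤ t are blue.  This blue "half graph" on
-- 2d vertices contains a blue path on all of them and every out-directed tree
-- with d vertices.
--
-- The blue path gives R(P_n , P_m) ≤ 2(n + m): if m ≤ n, only a red path on m/2
-- vertices has to be found outside P, so the sum n + m drops.  The half graph
-- also reduces R(P_n , T) to R(P_m , T) at the cost of n vertices.  For the
-- latter, depth-first search on the red edges gives disjoint sets D, U with all
-- edges D → U blue and fewer than m vertices outside.  Since D contains a blue
-- path on m vertices, the vertices of T with more than m/2 descendants, which
-- form a path, are placed in D, and the remaining subtrees in U by induction.

module Submission where

open import Data.Bool.Base using (Bool; true; false; not)
open import Data.Empty using (⊥-elim)
open import Data.Fin.Base using (Fin; zero; suc; toℕ; fromℕ; inject₁; inject≤; opposite)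
import Data.Fin.Properties as Fin
open import Data.List.Base using (List; []; _∷_; _++_; _ʳ++_; length; map; lookup; allFin)
open import Data.List.Membership.Propositional using (_∈_)
open import Data.List.Membership.Propositional.Properties
  using (∈-++⁺ˡ; ∈-++⁺ʳ; ∈-++⁻; ∈-map⁺; ∈-map⁻; ∈-lookup; ∈-allFin; ∈-∃++)
open import Data.List.Properties
  using (length-ʳ++; length-++; length-map; length-tabulate; map-++; ++-assoc; ++-identityʳ)
open import Data.List.Relation.Binary.Permutation.Propositional
  using (_↭_; ↭-refl; ↭-sym; ↭-trans; ↭-reflexive; prep; ↭⇒↭ₛ)
open import Data.List.Relation.Binary.Permutation.Propositional.Properties
  using (++-commutativeMonoid; ++↭ʳ++; ↭-length; ++⁺ʳ; ++⁺ˡ; ++⁺; shift; All-resp-↭; ∈-resp-↭)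
import Data.List.Relation.Binary.Permutation.Setoid.Properties as ↭ₛ
open import Data.List.Relation.Unary.All as All using (All; []; _∷_)
import Data.List.Relation.Unary.All.Properties as All
open import Data.List.Relation.Unary.AllPairs using (AllPairs; []; _∷_)
open import Data.List.Relation.Unary.Any using (here; there)
open import Data.List.Relation.Unary.Linked as Linked using (Linked; []; [-]; _∷_)
open import Data.List.Relation.Unary.Unique.Propositional using (Unique)
open import Data.List.Relation.Unary.Unique.Propositional.Properties using (allFin⁺)
open import Data.Nat.Base
  using (ℕ; zero; suc; _+_; _*_; _≤_; _<_; z≤n; s≤s; s≤s⁻¹; ⌊_/2⌋; ⌈_/2⌉)
open import Data.Nat.Induction using (<-rec)
open import Data.Nat.Properties hiding (_≟_)
open import Data.Nat.Solver using (module +-*-Solver)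
open import Data.Product.Base using (Σ-syntax; ∃-syntax; ∃; _×_; _,_; proj₁; proj₂)
open import Data.Sum.Base as Sum using (_⊎_; inj₁; inj₂)
open import Data.Vec.Functional using (Vector) renaming (_∷_ to _◂_; [] to ◂[])
open import Function.Base using (id; _∘_)
open import Function.Definitions using (Injective)
open import Level using (0ℓ)
open import Relation.Binary.Construct.Closure.ReflexiveTransitive using (Star; ε; _◅_)
open import Relation.Binary.Construct.Closure.Symmetric using (fwd; bwd; symmetric)
open import Relation.Binary.Core using (Rel)
open import Relation.Binary.PropositionalEquality.Core
  using (_≡_; _≢_; refl; sym; trans; cong; cong₂; subst; subst₂)
open import Relation.Binary.PropositionalEquality.Properties using (setoid)
open import Relation.Nullary.Decidable
  using (Dec; yes; no; map′; _×-dec_; _⊎-dec_; _→-dec_; ¬?; decidable-stable)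
open import Relation.Nullary.Negation.Core using (¬_)
open import Defs

-- Colours, and lists as multisets

opp : Colour → Colour
opp red  = blue
opp blue = red

opp-involutive : ∀ c → opp (opp c) ≡ c
opp-involutive red  = refl
opp-involutive blue = refl

c-or-opp : ∀ c d → d ≡ c ⊎ d ≡ opp c
c-or-opp red  red  = inj₁ refl
c-or-opp red  blue = inj₂ refl
c-or-opp blue red  = inj₂ refl
c-or-opp blue blue = inj₁ refl

module _ {A : Set} where

  open import Algebra.Solver.CommutativeMonoid (++-commutativeMonoid {A = A})
    using (solve; _⊜_; _⊕_) public

  infix 4 _⊑_

  -- Inclusion of multisets.  A list that is part of a repetition-free list is
  -- itself repetition-free, so distinctness of vertices need not be tracked.
  record _⊑_ (xs S : List A) : Set where
    constructor part
    field
      rest  : List A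
      split : S ↭ xs ++ rest

  ⊑-refl : ∀ {S} → S ⊑ S
  ⊑-refl {S} = part [] (↭-reflexive (sym (++-identityʳ S)))

  ⊑-sub : ∀ {xs ys zs S} → xs ⊑ S → xs ↭ ys ++ zs → ys ⊑ S
  ⊑-sub {ys = ys} {zs} (part R p) q = part (zs ++ R)
    (↭-trans p (↭-trans (++⁺ʳ R q) (solve 3 (λ y z r → (y ⊕ z) ⊕ r ⊜ y ⊕ (z ⊕ r)) ↭-refl ys zs R)))

  ⊑-resp : ∀ {xs ys S} → xs ⊑ S → xs ↭ ys → ys ⊑ S
  ⊑-resp (part R p) q = part R (↭-trans p (++⁺ʳ R q))

  ⊑-trans : ∀ {xs ys zs} → xs ⊑ ys → ys ⊑ zs → xs ⊑ zs
  ⊑-trans (part _ p) s = ⊑-sub s p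

-- Monochromatic paths and half graphs

module Colouring {A : Set} (χ : A → A → Colour) where

  -- RPath: a path listed from its last vertex to its first.
  Path RPath : Colour → List A → Set
  Path  c = Linked (λ x y → χ x y ≡ c)
  RPath c = Linked (λ x y → χ y x ≡ c)

  HasPath : Colour → ℕ → List A → Set
  HasPath c n S = ∃[ P ] Path c P × n ≤ length P × P ⊑ S

  -- A path is used as a zipper with focus `r` and reversed front part `ρ`, so that cutting at `r`
  -- and exchanging either half needs no reindexing.
  zip-path : ∀ {c} r ρ {σ} → RPath c (r ∷ ρ) → Path c (r ∷ σ) → Path c (ρ ʳ++ (r ∷ σ))
  zip-path r []       _       q = q
  zip-path r (s ∷ ρ) (e ∷ p) q = zip-path s ρ p (e ∷ q)

  unzip-path : ∀ {c} r ρ {σ} → Path c (ρ ʳ++ (r ∷ σ)) → RPath c (r ∷ ρ) × Path c (r ∷ σ)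
  unzip-path r []      p = [-] , p
  unzip-path r (s ∷ ρ) p with unzip-path s ρ p
  ... | q , e ∷ t = e ∷ q , t

  join-path : ∀ {c} r ρ s {σ} → RPath c (r ∷ ρ) → χ r s ≡ c → Path c (s ∷ σ) →
              Path c ((r ∷ ρ) ʳ++ (s ∷ σ))
  join-path r ρ s p e q = zip-path r ρ p (e ∷ q)

  ʳ++-⊑ : ∀ (ρ : List A) {σ S} → ρ ++ σ ⊑ S → ρ ʳ++ σ ⊑ S
  ʳ++-⊑ ρ {σ} s = ⊑-resp s (++↭ʳ++ ρ σ)

  Pairs : Set
  Pairs = List (A × A)

  flat : Pairs → List A
  flat []            = []
  flat ((w , x) ∷ L) = w ∷ x ∷ flat L

  Above : Colour → A × A → A × A → Set
  Above c (w , x) (w′ , x′) = χ w x′ ≡ c × χ x w′ ≡ c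

  -- The pairs (w , x) are listed from the last vertex w of the path W to the
  -- first, so that edges lead from earlier pairs to later ones.
  HalfGraph : Colour → Pairs → Set
  HalfGraph c L = AllPairs (Above c) L × All (λ p → χ (proj₁ p) (proj₂ p) ≡ c) L

  -- The half graph between a path and a second path disjoint from it

  module Zigzag (c : Colour) (k : ℕ) (S : List A) where

    Longer : Set
    Longer = HasPath c (suc k) S

    longer : ∀ w ρ x {σ T} → RPath c (w ∷ ρ) → χ w x ≡ c → Path c (x ∷ σ) →
             k ≤ length ρ + length (x ∷ σ) → (w ∷ T) ++ ρ ++ (x ∷ σ) ⊑ S → Longer
    longer w ρ x {σ} {T} p e q l s =
      (w ∷ ρ) ʳ++ (x ∷ σ) , join-path w ρ x p e q ,
      subst (suc k ≤_) (sym (length-ʳ++ (w ∷ ρ))) (s≤s l) ,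
      ʳ++-⊑ (w ∷ ρ) (⊑-sub s
        (solve 4 (λ a t r b → (a ⊕ t) ⊕ r ⊕ b ⊜ ((a ⊕ r) ⊕ b) ⊕ t) ↭-refl
          (w ∷ []) T ρ (x ∷ σ)))

    -- A c-path ending in w and a c-path starting in x that would together be
    -- too long if w → x had colour c.
    Forbids : A → List A → A → Set
    Forbids w T x = ∃[ ρ ] ∃[ σ ] RPath c (w ∷ ρ) × Path c (x ∷ σ) ×
                    k ≤ length ρ + length (x ∷ σ) × (w ∷ T) ++ ρ ++ (x ∷ σ) ⊑ S

    forbid : ∀ {w} T (L : Pairs) → All (Forbids w T ∘ proj₂) L →
             Longer ⊎ All (λ p → χ w (proj₂ p) ≡ opp c) L
    forbid T []            []                        = inj₂ []
    forbid {w} T ((_ , x) ∷ L) ((ρ , σ , p , q , l , s) ∷ fs) with c-or-opp c (χ w x) | forbid T L fs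
    ... | inj₁ e | _       = inj₁ (longer w ρ x {T = T} p e q l s)
    ... | inj₂ _ | inj₁ P  = inj₁ P
    ... | inj₂ e | inj₂ es = inj₂ (e ∷ es)

    -- Witnesses survive while the new path advances: the path ending in `w` is prolonged to `w′`,
    -- which only adds to the length.
    extend : ∀ {w w′} T {x} → χ w w′ ≡ c → Forbids w (w′ ∷ T) x → Forbids w′ T x
    extend {w} {w′} T {x} e (ρ , σ , p , q , l , s) =
      w ∷ ρ , σ , e ∷ p , q , m≤n⇒m≤1+n l ,
      ⊑-resp s (solve 5 (λ a b t r y → (a ⊕ b ⊕ t) ⊕ r ⊕ y ⊜ (b ⊕ t) ⊕ (a ⊕ r) ⊕ y) ↭-refl
        (w ∷ []) (w′ ∷ []) T ρ (x ∷ σ))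

    -- The scan starts where `pre` ends, so the cut point on the old path only moves forward.
    -- Stopping at the last edge of colour `c` into `w` leaves none from `post′`.
    lastInto : ∀ w pre post →
      All (λ x → χ x w ≡ opp c) post ⊎
      (∃[ p ] ∃[ pre′ ] ∃[ post′ ] (p ∷ pre′) ʳ++ post′ ≡ pre ʳ++ post × χ p w ≡ c ×
        All (λ x → χ x w ≡ opp c) post′ × (∃[ mid ] post ≡ mid ++ post′))
    lastInto w pre []         = inj₁ []
    lastInto w pre (x ∷ post) with lastInto w (x ∷ pre) post | c-or-opp c (χ x w)
    ... | inj₂ (p , pre′ , post′ , eq , e , a , mid , refl) | _ = inj₂ (p , pre′ , post′ , eq , e , a , x ∷ mid , refl)
    ... | inj₁ a | inj₁ e = inj₂ (x , pre , post , refl , e , a , x ∷ [] , refl)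
    ... | inj₁ a | inj₂ e = inj₁ (e ∷ a)

    Result : ℕ → Set
    Result n = Longer ⊎ (∃[ L ] HalfGraph (opp c) L × length L ≡ n × flat L ⊑ S)

    -- π is the longest c-path that ends in the vertex before w and consists
    -- of a prefix of the old path followed by a segment of the new one; pre
    -- is the reversed prefix of the old path that has as many vertices.
    go : ∀ w ws pre post π (L : Pairs) → Path c (w ∷ ws) → Path c (pre ʳ++ post) → RPath c (w ∷ π) →
         length π + length post ≡ k → length pre + length post ≡ k →
         (w ∷ ws) ++ π ++ post ⊑ S → (w ∷ ws) ++ pre ++ post ⊑ S → (w ∷ ws) ++ flat L ++ post ⊑ S →
         HalfGraph (opp c) L → All (Forbids w ws ∘ proj₂) L →
         All (λ x → All (λ p → χ x (proj₁ p) ≡ opp c) L) post →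
         Result (length L + length (w ∷ ws))

    -- Since no edge of colour `c` leads from `post` to `w`, the first vertex of `post` can become
    -- the partner of `w`. The inclusions in `S` are kept separate because `π`, `pre` and the pairs
    -- may overlap one another.
    insert : ∀ w ws pre post π (L : Pairs) → Path c (w ∷ ws) → Path c (pre ʳ++ post) → RPath c (w ∷ π) →
         length π + length post ≡ k → length pre + length post ≡ k →
         (w ∷ ws) ++ π ++ post ⊑ S → (w ∷ ws) ++ pre ++ post ⊑ S → (w ∷ ws) ++ flat L ++ post ⊑ S →
         HalfGraph (opp c) L → All (Forbids w ws ∘ proj₂) L →
         All (λ x → All (λ p → χ x (proj₁ p) ≡ opp c) L) post →
         All (λ x → χ x w ≡ opp c) post →
         Result (length L + length (w ∷ ws))
    -- With the old path exhausted, `π` has `k` vertices and `w` makes it longer.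
    insert w ws pre [] π L W P p l₁ l₂ s₁ s₂ s₃ h fs bs b =
      inj₁ ((w ∷ π) ʳ++ [] , zip-path w π p [-] ,
            ≤-reflexive (sym (trans (length-ʳ++ (w ∷ π)) (cong suc l₁))) ,
            ʳ++-⊑ (w ∷ π) (⊑-sub s₁
              (solve 4 (λ a t r b → (a ⊕ t) ⊕ r ⊕ b ⊜ ((a ⊕ r) ⊕ b) ⊕ t) ↭-refl
                (w ∷ []) ws π [])))
    insert w ws pre (x ∷ post) π L W P p l₁ l₂ s₁ s₂ s₃ (h , d) fs (b₀ ∷ bs) (b ∷ b′)
      with c-or-opp c (χ w x) | forbid ws L fs
    -- An edge `w → x` of colour `c` would splice `π`, `w` and the old path from `x` on into a path
    -- with `k + 1` vertices.
    ... | inj₁ e | _ = inj₁ (longer w π x {T = ws} p e (proj₂ (unzip-path x pre P)) (≤-reflexive (sym l₁)) s₁)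
    ... | inj₂ e | inj₁ P′ = inj₁ P′
    ... | inj₂ e | inj₂ es = next ws W s₁ s₂ s₃ fs
      where
      L′ = (w , x) ∷ L
      h′ : HalfGraph (opp c) L′
      h′ = All.zip (es , b₀) ∷ h , e ∷ d
      next : ∀ ws → Path c (w ∷ ws) →
             (w ∷ ws) ++ π ++ (x ∷ post) ⊑ S → (w ∷ ws) ++ pre ++ (x ∷ post) ⊑ S →
             (w ∷ ws) ++ flat L ++ (x ∷ post) ⊑ S → All (Forbids w ws ∘ proj₂) L →
             Result (length L + length (w ∷ ws))
      next [] _ _ _ s₃ _ = inj₂ (L′ , h′ , +-comm 1 (length L) ,
        ⊑-sub s₃ (solve 4 (λ w l x r → w ⊕ l ⊕ x ⊕ r ⊜ (w ⊕ x ⊕ l) ⊕ r) ↭-refl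
          (w ∷ []) (flat L) (x ∷ []) post))
      next (w′ ∷ ws) (ww′ ∷ W) s₁ s₂ s₃ fs =
        subst Result (sym (+-suc (length L) (suc (length ws))))
          (go w′ ws (x ∷ pre) post (w ∷ π) L′ W P (ww′ ∷ p)
            (trans (sym (+-suc (length π) _)) l₁) (trans (sym (+-suc (length pre) _)) l₂)
            (⊑-sub s₁ (solve 6 (λ a b t r y z → (a ⊕ b ⊕ t) ⊕ r ⊕ y ⊕ z ⊜ ((b ⊕ t) ⊕ (a ⊕ r) ⊕ z) ⊕ y) ↭-refl
              (w ∷ []) (w′ ∷ []) ws π (x ∷ []) post))
            (⊑-sub s₂ (solve 6 (λ a b t r y z → (a ⊕ b ⊕ t) ⊕ r ⊕ y ⊕ z ⊜ ((b ⊕ t) ⊕ (y ⊕ r) ⊕ z) ⊕ a) ↭-refl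
              (w ∷ []) (w′ ∷ []) ws pre (x ∷ []) post))
            (⊑-resp s₃ (solve 6 (λ a b t r y z → (a ⊕ b ⊕ t) ⊕ r ⊕ y ⊕ z ⊜ (b ⊕ t) ⊕ (a ⊕ y ⊕ r) ⊕ z) ↭-refl
              (w ∷ []) (w′ ∷ []) ws (flat L) (x ∷ []) post))
            h′
            -- The same splice is recorded for `x`, for use against all later vertices of the new
            -- path.
            (extend ws ww′ (π , post , p , proj₂ (unzip-path x pre P) , ≤-reflexive (sym l₁) , s₁)
              ∷ All.map (extend ws ww′) fs)
            (All.zipWith (λ (a , as) → a ∷ as) (b′ , bs)))

    go w ws pre post π L W P p l₁ l₂ s₁ s₂ s₃ h fs bs with lastInto w pre post
    ... | inj₁ b = insert w ws pre post π L W P p l₁ l₂ s₁ s₂ s₃ h fs bs b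
    ... | inj₂ (q , pre′ , post′ , eq , e , b , mid , refl) =
      -- As `π` and `pre` have equal length, the prefix of the old path up to `q` is longer than `π`
      -- and replaces it. The skipped vertices `mid` never enter a pair.
      insert w ws (q ∷ pre′) post′ (q ∷ pre′) L W P′ p′ l l s s
        (⊑-sub s₃ (solve 4 (λ a l m z → a ⊕ l ⊕ m ⊕ z ⊜ (a ⊕ l ⊕ z) ⊕ m) ↭-refl
          (w ∷ ws) (flat L) mid post′))
        h fs (All.++⁻ʳ mid bs) b
      where
      P′ : Path c ((q ∷ pre′) ʳ++ post′)
      P′ = subst (Path c) (sym eq) P
      p′ : RPath c (w ∷ q ∷ pre′)
      p′ = e ∷ proj₁ (unzip-path q pre′ P′)
      l : length (q ∷ pre′) + length post′ ≡ k
      l = trans (sym (length-ʳ++ (q ∷ pre′))) (trans (cong length eq) (trans (length-ʳ++ pre) l₂))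
      s : (w ∷ ws) ++ (q ∷ pre′) ++ post′ ⊑ S
      s = ⊑-resp s₂ (++⁺ˡ (w ∷ ws) (↭-trans (++↭ʳ++ pre (mid ++ post′))
            (subst (_↭ (q ∷ pre′) ++ post′) eq (↭-sym (++↭ʳ++ (q ∷ pre′) post′)))))

    -- Maximality of `P` becomes an alternative: wherever it would be invoked, a path on `k + 1`
    -- vertices is returned instead.
    zigzag : ∀ P W → Path c P → Path c W → length P ≡ k → P ++ W ⊑ S → Result (length W)
    zigzag P []       _ _ _ s = inj₂ ([] , ([] , []) , refl , part _ ↭-refl)
    zigzag P (w ∷ ws) p q l s = go w ws [] P [] [] q p [-] l l s′ s′ s′ ([] , []) [] (All.universal (λ _ → []) P)
      where
      s′ : (w ∷ ws) ++ P ⊑ S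
      s′ = ⊑-resp s (solve 2 (λ a b → a ⊕ b ⊜ b ⊕ a) ↭-refl P (w ∷ ws))

  -- Two directed paths

  HasPath-mono : ∀ {c n R S} → R ⊑ S → HasPath c n R → HasPath c n S
  HasPath-mono s (P , p , l , t) = P , p , l , ⊑-trans t s

  HasPath-≤ : ∀ {c n n′ S} → n′ ≤ n → HasPath c n S → HasPath c n′ S
  HasPath-≤ l′ (P , p , l , t) = P , p , ≤-trans l′ l , t

  HasHalfGraph : Colour → ℕ → List A → Set
  HasHalfGraph c d S = ∃[ L ] HalfGraph c L × d ≤ length L × flat L ⊑ S

  right-⊑ : ∀ {xs ys S : List A} → S ↭ xs ++ ys → ys ⊑ S
  right-⊑ {xs} {ys} p = part xs (↭-trans p (solve 2 (λ x y → x ⊕ y ⊜ y ⊕ x) ↭-refl xs ys))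

  length-↭-++ : ∀ {S : List A} xs {ys} → S ↭ xs ++ ys → length S ≡ length xs + length ys
  length-↭-++ xs p = trans (↭-length p) (length-++ xs)

  -- Repeated lengthening stands in for the choice of a longest path. Each round looks at the
  -- vertices outside `P`; `X` is any other outcome that ends the process, and `n` rounds suffice.
  grow : ∀ c n d S {X : Set} →
         (∀ P R → length P < n → S ↭ P ++ R → HasPath c d R ⊎ X) →
         HasPath c n S ⊎ HasHalfGraph (opp c) d S ⊎ X
  grow c n d S {X} step = go n [] [] (part S ↭-refl) (≤-reflexive (sym (+-identityʳ n)))
    where
    go : ∀ fuel P → Path c P → P ⊑ S → n ≤ fuel + length P →
         HasPath c n S ⊎ HasHalfGraph (opp c) d S ⊎ X
    go zero       P p s l = inj₁ (P , p , l , s)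
    go (suc fuel) P p s@(part R e) l with n ≤? length P
    ... | yes n≤ = inj₁ (P , p , n≤ , s)
    ... | no n≰ with step P R (≰⇒> n≰) e
    ...   | inj₂ x = inj₂ (inj₂ x)
    ...   | inj₁ (W , q , lw , part R′ e′)
      with Zigzag.zigzag c (length P) S P W p q refl
             (part R′ (↭-trans e (↭-trans (++⁺ˡ P e′)
               (solve 3 (λ a b r → a ⊕ b ⊕ r ⊜ (a ⊕ b) ⊕ r) ↭-refl P W R′))))
    ...     | inj₂ (L , h , ll , t) = inj₂ (inj₁ (L , h , ≤-trans lw (≤-reflexive (sym ll)) , t))
    ...     | inj₁ (P′ , p′ , l′ , s′) =
      go fuel P′ p′ s′ (≤-trans l (≤-trans (≤-reflexive (sym (+-suc fuel _))) (+-monoʳ-≤ fuel l′)))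

  -- The path alternates between `w → x` inside a pair and `x → w′` to the next pair.
  flat-path : ∀ {c} L → HalfGraph c L → Path c (flat L)
  flat-path []                         _ = []
  flat-path ((w , x) ∷ [])             (_ , e ∷ _) = e ∷ [-]
  flat-path ((w , x) ∷ (w′ , x′) ∷ L) (((_ , f) ∷ _) ∷ h , e ∷ d) =
    e ∷ f ∷ flat-path ((w′ , x′) ∷ L) (h , d)

  length-flat : ∀ (L : Pairs) → length (flat L) ≡ length L + length L
  length-flat []            = refl
  length-flat ((w , x) ∷ L) = cong suc (trans (cong suc (length-flat L)) (sym (+-suc (length L) (length L))))

  singleton-path : ∀ {c} S → 1 ≤ length S → HasPath c 1 S
  singleton-path (x ∷ S) _ = x ∷ [] , [-] , ≤-refl , part S ↭-refl

  n≤⌈n/2⌉+⌈n/2⌉ : ∀ n → n ≤ ⌈ n /2⌉ + ⌈ n /2⌉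
  n≤⌈n/2⌉+⌈n/2⌉ n = ≤-trans (≤-reflexive (sym (⌊n/2⌋+⌈n/2⌉≡n n))) (+-monoˡ-≤ ⌈ n /2⌉ (⌊n/2⌋≤⌈n/2⌉ n))

  -- A half graph on `⌈ m /2⌉` pairs already contains a path on `m` vertices, so the recursive call
  -- asks for `⌈ m /2⌉` in place of `n`.
  path-ramsey-≥ : ∀ c n m S →
    (∀ n′ m′ S′ → n′ + m′ < n + m → 2 * (n′ + m′) ≤ length S′ → HasPath c n′ S′ ⊎ HasPath (opp c) m′ S′) →
    m ≤ n → 2 * (n + m) ≤ length S → HasPath c n S ⊎ HasPath (opp c) m S
  path-ramsey-≥ c n zero S ih m≤n l = inj₂ ([] , [] , z≤n , part S ↭-refl)
  -- Separate because `⌈ 1 /2⌉ = 1` need not be less than `n`.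
  path-ramsey-≥ c n (suc zero) S ih m≤n l = inj₂ (singleton-path S
    (≤-trans (s≤s z≤n) (≤-trans (≤-trans (≤-reflexive (+-comm 1 n)) (m≤m+n (n + 1) _)) l)))
  path-ramsey-≥ c n m@(suc (suc m′)) S ih m≤n l with grow c n h S step
    where
    h = ⌈ m /2⌉
    step : ∀ P R → length P < n → S ↭ P ++ R → HasPath c h R ⊎ HasPath (opp c) m S
    step P R P<n e with ih h m R (+-monoˡ-< m (<-≤-trans (⌈n/2⌉<n m′) m≤n)) R-large
      where
      -- Rounding up costs one vertex, `2 * h ≤ suc n`; the strict `length P < n` pays for it.
      R-large : 2 * (h + m) ≤ length R
      R-large = +-cancelˡ-≤ (length P) _ _ (begin
        length P + 2 * (h + m)      ≤⟨ +-monoʳ-≤ (length P) (≤-reflexive (*-distribˡ-+ 2 h m)) ⟩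
        length P + (2 * h + 2 * m)  ≤⟨ +-monoʳ-≤ (length P) (+-monoˡ-≤ (2 * m) 2h≤) ⟩
        length P + (suc n + 2 * m)  ≡⟨ +-suc (length P) _ ⟩
        suc (length P) + (n + 2 * m) ≤⟨ +-monoˡ-≤ _ P<n ⟩
        n + (n + 2 * m)             ≡⟨ S.solve 2 (λ n m → n S.:+ (n S.:+ S.con 2 S.:* m) S.:= S.con 2 S.:* (n S.:+ m)) refl n m ⟩
        2 * (n + m)                 ≤⟨ l ⟩
        length S                    ≡⟨ length-↭-++ P e ⟩
        length P + length R         ∎)
        where
        open ≤-Reasoning
        module S = +-*-Solver
        2h≤ : 2 * h ≤ suc n
        2h≤ = begin
          h + (h + 0)               ≡⟨ cong (h +_) (+-identityʳ h) ⟩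
          h + h                     ≤⟨ +-monoˡ-≤ h (⌊n/2⌋≤⌈n/2⌉ (suc m)) ⟩
          ⌈ suc m /2⌉ + h           ≡⟨ +-comm ⌈ suc m /2⌉ h ⟩
          ⌊ suc m /2⌋ + ⌈ suc m /2⌉ ≡⟨ ⌊n/2⌋+⌈n/2⌉≡n (suc m) ⟩
          suc m                     ≤⟨ s≤s m≤n ⟩
          suc n                     ∎
    ... | inj₁ W = inj₁ W
    ... | inj₂ Q = inj₂ (HasPath-mono (right-⊑ e) Q)
  ... | inj₁ P = inj₁ P
  ... | inj₂ (inj₂ Q) = inj₂ Q
  ... | inj₂ (inj₁ (L , hg , ll , s)) = inj₂ (flat L , flat-path L hg ,
          ≤-trans (n≤⌈n/2⌉+⌈n/2⌉ m) (≤-trans (+-mono-≤ ll ll) (≤-reflexive (sym (length-flat L)))) , s)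

  path-ramsey-fuel : ∀ f c n m S → n + m < f → 2 * (n + m) ≤ length S →
                     HasPath c n S ⊎ HasPath (opp c) m S
  path-ramsey-fuel (suc f) c n m S (s≤s f≥) l with ≤-total m n
  ... | inj₁ m≤n = path-ramsey-≥ c n m S (λ n′ m′ S′ l → path-ramsey-fuel f c n′ m′ S′ (<-≤-trans l f≥)) m≤n l
  -- The longer target has to come first, so the colours change places.
  ... | inj₂ n≤m
    with path-ramsey-≥ (opp c) m n S
           (λ n′ m′ S′ l → path-ramsey-fuel f (opp c) n′ m′ S′ (<-≤-trans l (≤-trans (≤-reflexive (+-comm m n)) f≥)))
           n≤m (subst (λ x → 2 * x ≤ length S) (+-comm n m) l)
  ...   | inj₁ P = inj₂ P
  ...   | inj₂ P = inj₁ (subst (λ d → HasPath d n S) (opp-involutive c) P)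

  abstract
    path-ramsey : ∀ c n m S → 2 * (n + m) ≤ length S → HasPath c n S ⊎ HasPath (opp c) m S
    path-ramsey c n m S = path-ramsey-fuel (suc (n + m)) c n m S ≤-refl

  -- Depth-first search along one colour

  Sees : Colour → List A → A → Set
  Sees c U x = All (λ u → χ x u ≡ c) U

  outEdge : ∀ c x U → Sees (opp c) U x ⊎ (∃[ u ] ∃[ U′ ] χ x u ≡ c × U ↭ u ∷ U′)
  outEdge c x []      = inj₁ []
  outEdge c x (u ∷ U) with c-or-opp c (χ x u) | outEdge c x U
  ... | inj₁ e | _                      = inj₂ (u , U , e , ↭-refl)
  ... | inj₂ _ | inj₂ (v , U′ , e , p) = inj₂ (v , u ∷ U′ , e ,
    ↭-trans (prep u p) (solve 3 (λ a b r → a ⊕ b ⊕ r ⊜ b ⊕ a ⊕ r) ↭-refl (u ∷ []) (v ∷ []) U′))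
  ... | inj₂ e | inj₁ es                = inj₁ (e ∷ es)

  Sees-⊑ : ∀ {c U U′ x} → U′ ⊑ U → Sees c U x → Sees c U′ x
  Sees-⊑ {U′ = U′} (part _ p) s = All.++⁻ˡ U′ (All-resp-↭ p s)

  RPath⇒HasPath : ∀ {c S} P → RPath c P → P ⊑ S → HasPath c (length P) S
  RPath⇒HasPath []      _ s = [] , [] , z≤n , s
  RPath⇒HasPath (p ∷ P) r s = (p ∷ P) ʳ++ [] , zip-path p P r [-] ,
    ≤-reflexive (sym (trans (length-ʳ++ (p ∷ P)) (+-identityʳ _))) ,
    ʳ++-⊑ (p ∷ P) (⊑-resp s (↭-reflexive (sym (++-identityʳ (p ∷ P)))))

  -- The state of a depth-first search along the edges of colour c: P is the
  -- stack and D consists of the vertices that have left it.  A vertex leaves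
  -- only when no edge of colour c leads from it to the unvisited set U.
  record Searched (c : Colour) (n a : ℕ) (S : List A) : Set where
    field
      {D P U} : List A
      split   : S ↭ D ++ P ++ U
      sees    : All (Sees (opp c) U) D
      short   : length P < n
      done    : length D ≡ a

  abstract
    -- A stack of `n` vertices is a path. Otherwise `D` grows by single vertices and the search
    -- stops at exactly `a` of them. It cannot run dry earlier: with the stack and `U` empty, all of
    -- `S` would lie in `D`.
    search : ∀ c n a S → a + n ≤ length S → HasPath c n S ⊎ Searched c n a S
    search c zero    a S _ = inj₁ ([] , [] , z≤n , part S ↭-refl)
    search c n@(suc n′) a S big =
      -- The fuel bounds `2|U| + |P|`, which drops by one at a push and at a pop alike. The counter,
      -- initially `a`, is the number of vertices still to leave.
      go (length S + length S) a [] [] S ↭-refl [] [] (s≤s z≤n) (+-identityʳ a) (≤-reflexive (+-identityʳ _))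
      where
      go : ∀ fuel b D P U → S ↭ D ++ P ++ U → All (Sees (opp c) U) D → RPath c P → length P < n →
           b + length D ≡ a → (length U + length U) + length P ≤ fuel → HasPath c n S ⊎ Searched c n a S
      push : ∀ fuel b D P u U′ U → S ↭ D ++ P ++ U → U ↭ u ∷ U′ → All (Sees (opp c) U) D →
             RPath c (u ∷ P) → length P < n →
             b + length D ≡ a → (length U + length U) + length P ≤ suc fuel → HasPath c n S ⊎ Searched c n a S
      push fuel b D P u U′ U p q d r l eq f with n ≤? length (u ∷ P)
      ... | yes n≤ = inj₁ (HasPath-≤ n≤ (RPath⇒HasPath (u ∷ P) r (part (D ++ U′) (↭-trans p′
                (solve 4 (λ d u p v → d ⊕ (u ⊕ p) ⊕ v ⊜ (u ⊕ p) ⊕ d ⊕ v) ↭-refl D (u ∷ []) P U′)))))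
        where
        p′ : S ↭ D ++ (u ∷ P) ++ U′
        p′ = ↭-trans p (↭-trans (++⁺ˡ D (++⁺ˡ P q))
               (solve 4 (λ d u p v → d ⊕ p ⊕ u ⊕ v ⊜ d ⊕ (u ⊕ p) ⊕ v) ↭-refl D (u ∷ []) P U′))
      ... | no n≰ = go fuel b D (u ∷ P) U′
              (↭-trans p (↭-trans (++⁺ˡ D (++⁺ˡ P q))
               (solve 4 (λ d u p v → d ⊕ p ⊕ u ⊕ v ⊜ d ⊕ (u ⊕ p) ⊕ v) ↭-refl D (u ∷ []) P U′)))
              (All.map (Sees-⊑ (right-⊑ {xs = u ∷ []} q)) d) r (≰⇒> n≰) eq
              (s≤s⁻¹ (≤-trans (≤-reflexive f′) f))
        where
        f′ : suc ((length U′ + length U′) + suc (length P)) ≡ (length U + length U) + length P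
        f′ = trans (+-*-Solver.solve 2 (λ u p → con 1 :+ ((u :+ u) :+ (con 1 :+ p)) := ((con 1 :+ u) :+ (con 1 :+ u)) :+ p)
                     refl (length U′) (length P))
                   (cong (λ x → (x + x) + length P) (sym (↭-length q)))
          where open +-*-Solver using (con; _:+_; _:=_)
      go fuel zero D P U p d r l eq f = inj₂ (record { split = p ; sees = d ; short = l ; done = eq })
      go fuel (suc b) D [] [] p d r l eq f = ⊥-elim (<-irrefl refl (begin-strict
        length S        ≡⟨ length-↭-++ D p ⟩
        length D + 0    ≡⟨ +-identityʳ _ ⟩
        length D        <⟨ s≤s (m≤n+m (length D) b) ⟩
        suc b + length D ≡⟨ eq ⟩
        a               ≤⟨ m≤m+n a n ⟩
        a + n           ≤⟨ big ⟩
        length S        ∎))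
        where open ≤-Reasoning
      go (suc fuel) (suc b) D [] (u ∷ U) p d r l eq f = push fuel (suc b) D [] u U (u ∷ U) p ↭-refl d [-] l eq f
      go (suc fuel) (suc b) D (x ∷ P) U p d r l eq f with outEdge c x U
      ... | inj₂ (u , U′ , e , q) = push fuel (suc b) D (x ∷ P) u U′ U p q d (e ∷ r) l eq f
      ... | inj₁ s = go fuel b (x ∷ D) P U
              (↭-trans p (solve 4 (λ d u p v → d ⊕ (u ⊕ p) ⊕ v ⊜ (u ⊕ d) ⊕ p ⊕ v) ↭-refl D (x ∷ []) P U))
              (s ∷ d) (Linked.tail r) (<-trans (n<1+n _) l) (trans (+-suc b _) eq)
              (s≤s⁻¹ (≤-trans (≤-reflexive (sym (+-suc (length U + length U) _))) f))
      go zero (suc b) D [] (u ∷ U) p d r l eq ()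
      go zero (suc b) D (x ∷ P) U p d r l eq f = ⊥-elim (n≮0 (≤-trans (≤-reflexive (sym (+-suc (length U + length U) (length P)))) f))

-- Rooted trees and their embeddings

data Tree (B : Set) : Set where
  node : B → List (Tree B) → Tree B

module _ {B : Set} where

  labels  : Tree B → List B
  labelsF : List (Tree B) → List B
  labels (node v ts) = v ∷ labelsF ts
  labelsF []       = []
  labelsF (t ∷ ts) = labels t ++ labelsF ts

  size : Tree B → ℕ
  size t = length (labels t)

  sizeF : List (Tree B) → ℕ
  sizeF ts = length (labelsF ts)

  sizeF-∷ : ∀ t ts → sizeF (t ∷ ts) ≡ size t + sizeF ts
  sizeF-∷ t ts = length-++ (labels t)

x+[y+z]≡y+[x+z] : ∀ x y z → x + (y + z) ≡ y + (x + z)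
x+[y+z]≡y+[x+z] = +-*-Solver.solve 3 (λ x y z → x :+ (y :+ z) := y :+ (x :+ z)) refl
  where open +-*-Solver using (_:+_; _:=_)

module Trees {A : Set} (χ : A → A → Colour) {B : Set} where
  open Colouring χ

  -- Emb c t a es: t is embedded with all edges of colour c and root a; es
  -- lists the pairs of a label and its image in preorder.
  data Emb (c : Colour) : Tree B → A → List (B × A) → Set
  data EmbF (c : Colour) : List (Tree B) → A → List (B × A) → Set

  data Emb c where
    node : ∀ {v ts a es} → EmbF c ts a es → Emb c (node v ts) a ((v , a) ∷ es)

  data EmbF c where
    []  : ∀ {a} → EmbF c [] a []
    cons : ∀ {t ts a b es es′} → χ a b ≡ c → Emb c t b es → EmbF c ts a es′ →
           EmbF c (t ∷ ts) a (es ++ es′)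

  emb-labels  : ∀ {c t a es} → Emb c t a es → map proj₁ es ≡ labels t
  embF-labels : ∀ {c ts a es} → EmbF c ts a es → map proj₁ es ≡ labelsF ts
  emb-labels (node e) = cong (_ ∷_) (embF-labels e)
  embF-labels [] = refl
  embF-labels (cons {es = es} {es′} _ e es′′) =
    trans (map-++ proj₁ es es′) (cong₂ _++_ (emb-labels e) (embF-labels es′′))

  images : List (B × A) → List A
  images = map proj₂

  emb-size : ∀ {c t a es} → Emb c t a es → length (images es) ≡ size t
  emb-size {es = es} e = trans (length-map proj₂ es) (trans (sym (length-map proj₁ es)) (cong length (emb-labels e)))

  HasTree : Colour → Tree B → List A → Set
  HasTree c t S = ∃[ a ] ∃[ es ] Emb c t a es × images es ⊑ S

  HasTree-mono : ∀ {c t R S} → R ⊑ S → HasTree c t R → HasTree c t S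
  HasTree-mono s (a , es , e , i) = a , es , e , ⊑-trans i s

  side : Bool → A × A → A
  side true  = proj₁
  side false = proj₂

  Above-side : ∀ {c} b {p q} → Above c p q → χ (side b p) (side (not b) q) ≡ c
  Above-side true  (e , f) = e
  Above-side false (e , f) = f

  flat-++ : ∀ (L L′ : Pairs) → flat (L ++ L′) ≡ flat L ++ flat L′
  flat-++ []            L′ = refl
  flat-++ ((w , x) ∷ L) L′ = cong (λ l → w ∷ x ∷ l) (flat-++ L L′)

  AllPairs-++⁻ʳ : ∀ {c} (L {L′} : Pairs) → AllPairs (Above c) (L ++ L′) → AllPairs (Above c) L′
  AllPairs-++⁻ʳ []      ps       = ps
  AllPairs-++⁻ʳ (_ ∷ L) (_ ∷ ps) = AllPairs-++⁻ʳ L ps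

  side-⊑ : ∀ b q {es} (L : Pairs) → images es ⊑ flat L → side b q ∷ images es ⊑ flat (q ∷ L)
  side-⊑ true (w , x) {es} L (part R p) = part (x ∷ R)
    (prep w (↭-trans (prep x p) (solve 3 (λ a b c → a ⊕ b ⊕ c ⊜ b ⊕ a ⊕ c) ↭-refl (x ∷ []) (images es) R)))
  side-⊑ false (w , x) {es} L (part R p) = part (w ∷ R)
    (↭-trans (prep w (prep x p))
      (solve 4 (λ w a b c → w ⊕ a ⊕ b ⊕ c ⊜ (a ⊕ b) ⊕ w ⊕ c) ↭-refl (w ∷ []) (x ∷ []) (images es) R))

  ++-⊑ : ∀ {xs ys S T : List A} → xs ⊑ S → ys ⊑ T → xs ++ ys ⊑ S ++ T
  ++-⊑ {xs} {ys} (part R p) (part R′ q) = part (R ++ R′) (↭-trans (++⁺ p q)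
    (solve 4 (λ a b c d → (a ⊕ b) ⊕ c ⊕ d ⊜ (a ⊕ c) ⊕ b ⊕ d) ↭-refl xs R ys R′))

  -- The pairs are used up in preorder; the side of a vertex is the parity of
  -- its depth.
  embed-half : ∀ {c} ts b p L → AllPairs (Above c) L → All (Above c p) L → sizeF ts ≤ length L →
    ∃[ es ] ∃[ L₁ ] ∃[ L₂ ] L ≡ L₁ ++ L₂ × EmbF c ts (side b p) es × images es ⊑ flat L₁ × length L₁ ≡ sizeF ts
  embed-half []                 b p L       h a l = [] , [] , L , refl , [] , ⊑-refl , refl
  embed-half (node v us ∷ ts) b p (q ∷ L) (a′ ∷ h) (e ∷ a) (s≤s l)
    with embed-half us (not b) q L h a′
           (≤-trans (m≤m+n (sizeF us) (sizeF ts)) (≤-trans (≤-reflexive (sym (length-++ (labelsF us)))) l))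
  ... | es₁ , L₁ , L₂ , refl , e₁ , i₁ , l₁
    with embed-half ts b p L₂ (AllPairs-++⁻ʳ L₁ h) (All.++⁻ʳ L₁ a)
           (+-cancelˡ-≤ (length L₁) _ _ (≤-trans (≤-reflexive (trans (cong (_+ sizeF ts) l₁) (sym (length-++ (labelsF us)))))
             (≤-trans l (≤-reflexive (length-++ L₁)))))
  ... | es₂ , L₃ , L₄ , refl , e₂ , i₂ , l₂ =
    (v , side (not b) q) ∷ es₁ ++ es₂ , q ∷ L₁ ++ L₃ , L₄ , cong (q ∷_) (sym (++-assoc L₁ L₃ L₄)) ,
    cons (Above-side b e) (node e₁) e₂ ,
    subst (side (not b) q ∷ images (es₁ ++ es₂) ⊑_) (sym (flat-++ (q ∷ L₁) L₃))
      (subst (λ x → side (not b) q ∷ x ⊑ _) (sym (map-++ proj₂ es₁ es₂)) (++-⊑ (side-⊑ (not b) q {es₁} L₁ i₁) i₂)) ,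
    cong suc (trans (length-++ L₁) (trans (cong₂ _+_ l₁ l₂) (sym (length-++ (labelsF us)))))

  half⇒tree : ∀ {c S} t → HasHalfGraph c (size t) S → HasTree c t S
  half⇒tree (node v ts) (p ∷ L , (a ∷ h , _) , s≤s l , s) with embed-half ts true p L h a l
  ... | es , L₁ , L₂ , refl , e , i , _ =
    proj₁ p , (v , proj₁ p) ∷ es , node e ,
    ⊑-trans (side-⊑ true p {es} L₁ i)
      (⊑-sub s (↭-reflexive (cong (λ l → proj₁ p ∷ proj₂ p ∷ l) (flat-++ L₁ L₂))))

  -- Subtrees with more than k vertices are rooted along the path hs; since
  -- there are at most 2k vertices, no two siblings are that large.
  module Spine (c : Colour) (k N : ℕ) (V : List A) (X : Set)
    (small : ∀ t U → size t ≤ k → N ≤ length U → U ⊑ V → X ⊎ HasTree c t U) where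

    abstract
      spine : ∀ ts h hs U → Path c (h ∷ hs) → All (Sees c U) (h ∷ hs) → U ⊑ V →
        sizeF ts ≤ k + k → sizeF ts ≤ k + length hs → N + sizeF ts ≤ length U →
        X ⊎ (∃[ es ] ∃[ J ] ∃[ U′ ] EmbF c ts h es × hs ++ U ↭ images es ++ J ++ U′ ×
             U′ ⊑ U × length U ≤ length U′ + sizeF ts)
      spine [] h hs U p s i l₁ l₂ l₃ = inj₂ ([] , hs , U , [] , ↭-refl , ⊑-refl , m≤m+n (length U) 0)
      spine (t@(node v us) ∷ ts) h hs U p s@(s₀ ∷ _) i l₁ l₂ l₃ with size t ≤? k
      ... | yes t≤k with small t U t≤k (≤-trans (m≤m+n N _) l₃) i
      ...   | inj₁ x = inj₁ x
      ...   | inj₂ (a , es , e , part R q)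
        with spine ts h hs R p (All.map (Sees-⊑ (right-⊑ q)) s) (⊑-trans (right-⊑ q) i)
               (≤-trans ts≤ l₁) (≤-trans ts≤ l₂) R-large
        where
        ts≤ : sizeF ts ≤ sizeF (t ∷ ts)
        ts≤ = ≤-trans (m≤n+m (sizeF ts) (size t)) (≤-reflexive (sym (sizeF-∷ t ts)))
        R-large : N + sizeF ts ≤ length R
        R-large = +-cancelˡ-≤ (size t) _ _ (begin
          size t + (N + sizeF ts)  ≡⟨ x+[y+z]≡y+[x+z] (size t) N (sizeF ts) ⟩
          N + (size t + sizeF ts)  ≡⟨ cong (N +_) (sym (sizeF-∷ t ts)) ⟩
          N + sizeF (t ∷ ts)       ≤⟨ l₃ ⟩
          length U                 ≡⟨ length-↭-++ (images es) q ⟩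
          length (images es) + length R ≡⟨ cong (_+ length R) (emb-size e) ⟩
          size t + length R        ∎)
          where
          open ≤-Reasoning
      ...     | inj₁ x = inj₁ x
      ...     | inj₂ (es′ , J , U′ , e′ , q′ , i′ , l′) =
        inj₂ (es ++ es′ , J , U′ , cons edge e e′ ,
          ↭-trans (++⁺ˡ hs q) (↭-trans (solve 3 (λ h a r → h ⊕ a ⊕ r ⊜ a ⊕ h ⊕ r) ↭-refl hs (images es) R)
            (↭-trans (++⁺ˡ (images es) q′) (↭-trans
              (solve 4 (λ a b c d → a ⊕ b ⊕ c ⊕ d ⊜ (a ⊕ b) ⊕ c ⊕ d) ↭-refl (images es) (images es′) J U′)
              (↭-reflexive (cong (_++ (J ++ U′)) (sym (map-++ proj₂ es es′))))))) ,
          ⊑-trans i′ (right-⊑ q) ,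
          (begin
            length U                              ≡⟨ length-↭-++ (images es) q ⟩
            length (images es) + length R         ≡⟨ cong (_+ length R) (emb-size e) ⟩
            size t + length R                     ≤⟨ +-monoʳ-≤ (size t) l′ ⟩
            size t + (length U′ + sizeF ts)       ≡⟨ x+[y+z]≡y+[x+z] (size t) (length U′) (sizeF ts) ⟩
            length U′ + (size t + sizeF ts)       ≡⟨ cong (length U′ +_) (sym (sizeF-∷ t ts)) ⟩
            length U′ + sizeF (t ∷ ts)            ∎))
        where
        open ≤-Reasoning
        edge : χ h a ≡ c
        edge = root-edge e (All-resp-↭ q s₀)
          where
          root-edge : ∀ {t a es R} → Emb c t a es → Sees c (images es ++ R) h → χ h a ≡ c
          root-edge (node _) (e ∷ _) = e
      -- With the path used up, the second size bound allows only `k` vertices.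
      spine (t@(node v us) ∷ ts) h [] U p s i l₁ l₂ l₃ | no t≰k =
        ⊥-elim (t≰k (≤-trans (m≤m+n (size t) (sizeF ts)) (≤-trans (≤-reflexive (sym (sizeF-∷ t ts)))
          (≤-trans l₂ (≤-reflexive (+-identityʳ k))))))
      spine (t@(node v us) ∷ ts) h (h′ ∷ hs) U (e ∷ p) (s₀ ∷ s) i l₁ l₂ l₃ | no t≰k
        with spine us h′ hs U p s i
               (≤-trans (n≤1+n _) (≤-trans t≤ l₁))
               (s≤s⁻¹ (≤-trans t≤ (≤-trans l₂ (≤-reflexive (+-suc k _)))))
               (≤-trans (+-monoʳ-≤ N (≤-trans (n≤1+n _) t≤)) l₃)
        where
        t≤ : size t ≤ sizeF (t ∷ ts)
        t≤ = ≤-trans (m≤m+n (size t) (sizeF ts)) (≤-reflexive (sym (sizeF-∷ t ts)))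
      ... | inj₁ x = inj₁ x
      ... | inj₂ (es , J , U′ , e₁ , q , i′ , l)
        -- The siblings of a large subtree have at most `k` vertices in all, so `h` alone suffices
        -- as a path for them.
        with spine ts h [] U′ [-] (Sees-⊑ i′ s₀ ∷ []) (⊑-trans i′ i)
               (≤-trans ts≤k (m≤m+n k k)) (≤-trans ts≤k (m≤m+n k 0)) U′-large
        where
        open ≤-Reasoning
        ts≤k : sizeF ts ≤ k
        ts≤k = +-cancelˡ-≤ k _ _ (begin
          k + sizeF ts       ≤⟨ +-monoˡ-≤ (sizeF ts) (<⇒≤ (≰⇒> t≰k)) ⟩
          size t + sizeF ts  ≡⟨ sizeF-∷ t ts ⟨
          sizeF (t ∷ ts)     ≤⟨ l₁ ⟩
          k + k              ∎)
        U′-large : N + sizeF ts ≤ length U′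
        U′-large = +-cancelˡ-≤ (sizeF us) _ _ (begin
          sizeF us + (N + sizeF ts)  ≡⟨ x+[y+z]≡y+[x+z] (sizeF us) N (sizeF ts) ⟩
          N + (sizeF us + sizeF ts)  ≤⟨ +-monoʳ-≤ N (n≤1+n _) ⟩
          N + (size t + sizeF ts)    ≡⟨ cong (N +_) (sizeF-∷ t ts) ⟨
          N + sizeF (t ∷ ts)         ≤⟨ l₃ ⟩
          length U                   ≤⟨ l ⟩
          length U′ + sizeF us       ≡⟨ +-comm (length U′) _ ⟩
          sizeF us + length U′       ∎)
      ...   | inj₁ x = inj₁ x
      ...   | inj₂ (es′ , J′ , U″ , e₂ , q′ , i″ , l′) =
        inj₂ ((v , h′) ∷ es ++ es′ , J ++ J′ , U″ , cons e (node e₁) e₂ ,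
          prep h′ (↭-trans q (↭-trans (++⁺ˡ (images es) (++⁺ˡ J q′)) (↭-trans
            (solve 5 (λ a j b j′ u → a ⊕ j ⊕ b ⊕ j′ ⊕ u ⊜ (a ⊕ b) ⊕ (j ⊕ j′) ⊕ u) ↭-refl (images es) J (images es′) J′ U″)
            (↭-reflexive (cong (_++ ((J ++ J′) ++ U″)) (sym (map-++ proj₂ es es′))))))) ,
          ⊑-trans i″ i′ ,
          (begin
            length U                              ≤⟨ l ⟩
            length U′ + sizeF us                  ≤⟨ +-monoˡ-≤ (sizeF us) l′ ⟩
            (length U″ + sizeF ts) + sizeF us     ≡⟨ +-assoc (length U″) _ _ ⟩
            length U″ + (sizeF ts + sizeF us)     ≡⟨ cong (length U″ +_) (+-comm (sizeF ts) _) ⟩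
            length U″ + (sizeF us + sizeF ts)     ≤⟨ +-monoʳ-≤ (length U″) (n≤1+n _) ⟩
            length U″ + (size t + sizeF ts)       ≡⟨ cong (length U″ +_) (sizeF-∷ t ts) ⟨
            length U″ + sizeF (t ∷ ts)            ∎))
        where open ≤-Reasoning

-- Induction on the size of the tree

module Main {A : Set} (χ : A → A → Colour) {B : Set} (c : Colour) where
  open Colouring χ
  open Trees χ {B}

  -- Quantifying over `t`, `n` and `S` inside lets the induction treat subtrees, with `m` in place
  -- of `n`, within subsets of the unvisited vertices.
  TreeRamsey : ℕ → Set
  TreeRamsey m = ∀ t → size t ≤ m → ∀ n S → n + 14 * m ≤ length S →
                 HasPath c n S ⊎ HasTree (opp c) t S

  module _ (m : ℕ) (ih : ∀ {k} → k < m → TreeRamsey k) where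

    k : ℕ
    k = ⌊ m /2⌋

    open ≤-Reasoning

    abstract
      k<m : ∀ {s} → suc s ≤ m → k < m
      k<m = go m
        where
        go : ∀ m {s} → suc s ≤ m → ⌊ m /2⌋ < m
        go (suc m) _ = ⌊n/2⌋<n m

      -- The root is placed first; the other vertices, at most `m - 1`, fit into twice the
      -- rounded-down half.
      half-≤ : ∀ {s} → suc s ≤ m → s ≤ k + k
      half-≤ {s} s<m = s≤s⁻¹ (begin
        suc s                  ≤⟨ s<m ⟩
        m                      ≡⟨ ⌊n/2⌋+⌈n/2⌉≡n m ⟨
        k + ⌈ m /2⌉            ≤⟨ +-monoʳ-≤ k (⌊n/2⌋-mono (n≤1+n (suc m))) ⟩
        k + suc k              ≡⟨ +-suc k k ⟩
        suc (k + k)            ∎)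

      2k≤m : k + k ≤ m
      2k≤m = begin
        k + k        ≤⟨ +-monoʳ-≤ k (⌊n/2⌋≤⌈n/2⌉ m) ⟩
        k + ⌈ m /2⌉  ≡⟨ ⌊n/2⌋+⌈n/2⌉≡n m ⟩
        m            ∎

      4m+m≤14m : 4 * m + m ≤ 14 * m
      4m+m≤14m = ≤-trans (≤-reflexive (+-comm (4 * m) m)) (*-monoˡ-≤ m {5} {14} (≤ᵇ⇒≤ 5 14 _))

      -- This fixes the constant 14: of 14m vertices, 4m go to D, m to the stack
      -- and m to the tree, and m + 14(m/2) must remain for each small subtree.
      budget : ∀ {d p s u} → d ≡ 4 * m → p < m → suc s ≤ m → 14 * m ≤ d + (p + u) →
               m + 14 * k + s ≤ u
      budget {d} {p} {s} {u} d≡ p<m s<m l = +-cancelˡ-≤ (d + p) _ _ (begin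
        (d + p) + (m + 14 * k + s)      ≤⟨ +-mono-≤ (+-mono-≤ (≤-reflexive d≡) (<⇒≤ p<m))
                                             (+-monoʳ-≤ (m + 14 * k) (<⇒≤ s<m)) ⟩
        (4 * m + m) + (m + 14 * k + m)  ≡⟨ lhs m k ⟩
        7 * m + 7 * (k + k)             ≤⟨ +-monoʳ-≤ (7 * m) (*-monoʳ-≤ 7 2k≤m) ⟩
        7 * m + 7 * m                   ≡⟨ *-distribʳ-+ m 7 7 ⟨
        14 * m                          ≤⟨ l ⟩
        d + (p + u)                     ≡⟨ +-assoc d p u ⟨
        (d + p) + u                     ∎)
        where
        lhs : ∀ m k → (4 * m + m) + (m + 14 * k + m) ≡ 7 * m + 7 * (k + k)
        lhs = +-*-Solver.solve 2 (λ m k → (con 4 :* m :+ m) :+ (m :+ con 14 :* k :+ m) := con 7 :* m :+ con 7 :* (k :+ k)) refl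
          where open +-*-Solver using (con; _:*_; _:+_; _:=_)

      2[m+m]≡4m : 2 * (m + m) ≡ 4 * m
      2[m+m]≡4m = +-*-Solver.solve 1 (λ m → con 2 :* (m :+ m) := con 4 :* m) refl m
        where open +-*-Solver using (con; _:*_; _:+_; _:=_)

    -- This is the case `n = m` from `14 * m` vertices alone, so that `tree-ramsey` can spend the
    -- whole summand `n` on the path it sets aside.
    tree-or-short-path : ∀ t → size t ≤ m → ∀ S → 14 * m ≤ length S →
                         HasPath c m S ⊎ HasTree (opp c) t S
    tree-or-short-path t@(node v ts) t≤m S l with search c m (4 * m) S (≤-trans 4m+m≤14m l)
    ... | inj₁ P = inj₁ P
    ... | inj₂ record { D = D ; P = P ; U = U ; split = e ; sees = sees ; short = P<m ; done = D≡ }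
      -- `D` has `4 * m = 2 * (m + m)` vertices, enough for a path on `m` vertices in one of the
      -- colours.
      with path-ramsey c m m D (≤-reflexive (trans 2[m+m]≡4m (sym D≡)))
    ...   | inj₁ Q = inj₁ (HasPath-mono (part (P ++ U) e) Q)
    ...   | inj₂ ([] , _ , m≤0 , _) = ⊥-elim (n≮0 (≤-trans t≤m m≤0))
    ...   | inj₂ (h ∷ hs , p , m≤hs , part R q)
      -- `m + 14 * k` is what the induction hypothesis demands for a path on `m` vertices and a tree
      -- of size at most `k`.
      with Spine.spine (opp c) k (m + 14 * k) U (HasPath c m S) small ts h hs U p
             (All.++⁻ˡ (h ∷ hs) (All-resp-↭ q sees)) ⊑-refl (half-≤ t≤m)
             (≤-trans (s≤s⁻¹ (≤-trans t≤m m≤hs)) (m≤n+m _ k))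
             (budget D≡ P<m t≤m (≤-trans l (≤-reflexive
               (trans (length-↭-++ D e) (cong (length D +_) (length-↭-++ P {U} ↭-refl))))))
      where
      U⊑S : U ⊑ S
      U⊑S = right-⊑ (↭-trans e (solve 3 (λ d p u → d ⊕ p ⊕ u ⊜ (d ⊕ p) ⊕ u) ↭-refl D P U))
      small : ∀ t U′ → size t ≤ k → m + 14 * k ≤ length U′ → U′ ⊑ U → HasPath c m S ⊎ HasTree (opp c) t U′
      small t U′ t≤k l s with ih (k<m t≤m) t t≤k m U′ l
      ... | inj₁ Q = inj₁ (HasPath-mono (⊑-trans s U⊑S) Q)
      ... | inj₂ T = inj₂ T
    ...     | inj₁ Q = inj₁ Q
    ...     | inj₂ (es , J , U′ , emb , i , _) = inj₂ (h , (v , h) ∷ es , node emb ,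
      part (J ++ U′ ++ R ++ P) (↭-trans e (↭-trans (++⁺ʳ (P ++ U) q)
        (↭-trans (solve 5 (λ h hs r p u → ((h ⊕ hs) ⊕ r) ⊕ p ⊕ u ⊜ h ⊕ (hs ⊕ u) ⊕ (r ⊕ p)) ↭-refl (h ∷ []) hs R P U)
          (prep h (↭-trans (++⁺ʳ (R ++ P) i)
            (solve 5 (λ a j u r p → (a ⊕ j ⊕ u) ⊕ r ⊕ p ⊜ a ⊕ j ⊕ u ⊕ r ⊕ p) ↭-refl (images es) J U′ R P)))))))

  tree-ramsey : ∀ m → TreeRamsey m
  tree-ramsey = <-rec TreeRamsey step
    where
    step : ∀ m → (∀ {k} → k < m → TreeRamsey k) → TreeRamsey m
    -- A half graph on `m` pairs has room for `t`, hence `d = m`.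
    step m ih t t≤m n S l with grow c n m S {HasTree (opp c) t S} inRest
      where
      inRest : ∀ P R → length P < n → S ↭ P ++ R → HasPath c m R ⊎ HasTree (opp c) t S
      inRest P R P<n e with tree-or-short-path m ih t t≤m R
        (+-cancelˡ-≤ (length P) _ _ (≤-trans (+-monoˡ-≤ (14 * m) (<⇒≤ P<n)) (≤-trans l (≤-reflexive (length-↭-++ P e)))))
      ... | inj₁ W = inj₁ W
      ... | inj₂ T = inj₂ (HasTree-mono (right-⊑ e) T)
    ... | inj₁ P = inj₁ P
    ... | inj₂ (inj₂ T) = inj₂ T
    ... | inj₂ (inj₁ (L , h , l′ , s)) = inj₂ (half⇒tree t (L , h , ≤-trans t≤m l′ , s))

-- Repetition-free lists

Unique-resp-↭ : ∀ {A : Set} {xs ys : List A} → xs ↭ ys → Unique xs → Unique ys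
Unique-resp-↭ p = ↭ₛ.Unique-resp-↭ (setoid _) (↭⇒↭ₛ p)

Unique-++⁻ˡ : ∀ {A : Set} (xs {ys} : List A) → Unique (xs ++ ys) → Unique xs
Unique-++⁻ˡ []       _       = []
Unique-++⁻ˡ (x ∷ xs) (a ∷ u) = All.++⁻ˡ xs a ∷ Unique-++⁻ˡ xs u

lookup-injective : ∀ {A : Set} {xs : List A} → Unique xs → ∀ i j → lookup xs i ≡ lookup xs j → i ≡ j
lookup-injective (_ ∷ _) zero    zero    _  = refl
lookup-injective (a ∷ _) zero    (suc j) eq = ⊥-elim (All.lookup a (∈-lookup j) eq)
lookup-injective (a ∷ _) (suc i) zero    eq = ⊥-elim (All.lookup a (∈-lookup i) (sym eq))
lookup-injective (_ ∷ u) (suc i) (suc j) eq = cong suc (lookup-injective u i j eq)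

linked-lookup : ∀ {A : Set} {R : Rel A 0ℓ} x xs → Linked R (x ∷ xs) →
                ∀ (i : Fin (length xs)) → R (lookup (x ∷ xs) (inject₁ i)) (lookup (x ∷ xs) (suc i))
linked-lookup x (y ∷ xs) (r ∷ l) zero    = r
linked-lookup x (y ∷ xs) (r ∷ l) (suc i) = linked-lookup y xs l i

lastOf : ∀ {A : Set} → A → List A → A
lastOf x []       = x
lastOf x (y ∷ ys) = lastOf y ys

lookup-last : ∀ {A : Set} (x : A) xs → lookup (x ∷ xs) (fromℕ (length xs)) ≡ lastOf x xs
lookup-last x []       = refl
lookup-last x (y ∷ xs) = lookup-last y xs

-- From out-directed trees to rooted trees

module _ {B : Set} where

  edges : B → List (Tree B) → List (B × B)
  edges v []               = []
  edges v (node u us ∷ ts) = (v , u) ∷ edges u us ++ edges v ts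

  parent : ∀ {y} v ts → y ∈ labelsF ts → ∃[ x ] (x , y) ∈ edges v ts
  parent v (node u us ∷ ts) (here refl) = v , here refl
  parent v (node u us ∷ ts) (there i) with ∈-++⁻ (labelsF us) i
  ... | inj₁ j = proj₁ (parent u us j) , there (∈-++⁺ˡ (proj₂ (parent u us j)))
  ... | inj₂ j = proj₁ (parent v ts j) , there (∈-++⁺ʳ (edges u us) (proj₂ (parent v ts j)))

module _ {m : ℕ} (T : Digraph m) where
  open Digraph T
  open import Data.List.Membership.DecPropositional (Fin._≟_ {m}) using (_∈?_)

  _∼_ : Rel (Fin m) 0ℓ
  _∼_ = Underlying T

  ∼-sym : ∀ {x y} → x ∼ y → y ∼ x
  ∼-sym = symmetric _⟶_

  -- The last component says that the shortened path avoids whatever the full one avoids, so that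
  -- further vertices can be put in front of it.
  prefix : ∀ {x} w ρ → x ∈ w ∷ ρ → Linked _∼_ (w ∷ ρ) → Unique (w ∷ ρ) →
           ∃[ σ ] Linked _∼_ (w ∷ σ) × Unique (w ∷ σ) × lastOf w σ ≡ x × (∀ {y} → All (y ≢_) ρ → All (y ≢_) σ)
  prefix w ρ       (here refl) l       u        = [] , [-] , [] ∷ [] , refl , λ _ → []
  prefix w (v ∷ ρ) (there i)   (e ∷ l) (a ∷ u) with prefix v ρ i l u
  ... | σ , l′ , u′ , last , f = v ∷ σ , e ∷ l′ , (All.head a ∷ f (All.tail a)) ∷ u′ , last ,
        λ { (b ∷ bs) → b ∷ f bs }

  -- The part of the path from `w` to `x` has at least three vertices, and the chord closes it to a
  -- cycle.
  no-chord : Acyclic _∼_ → ∀ {x} w p ρ → Linked _∼_ (w ∷ p ∷ ρ) → Unique (w ∷ p ∷ ρ) →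
             x ∈ ρ → ¬ x ∼ w
  no-chord acyclic w p (q ∷ ρ) (e ∷ f ∷ l) ((a ∷ b ∷ as) ∷ (c ∷ cs) ∷ u) i g with prefix q ρ i l u
  ... | σ , l′ , u′ , refl , except = acyclic (lookup xs) (s≤s (s≤s z≤n))
    ((λ {i} {j} → lookup-injective unique i j) , linked-lookup w (p ∷ q ∷ σ) (e ∷ f ∷ l′))
    (subst (_∼ w) (sym (lookup-last q σ)) g)
    where
    xs : List (Fin m)
    xs = w ∷ p ∷ q ∷ σ
    unique : Unique xs
    unique = (a ∷ b ∷ except as) ∷ (c ∷ except cs) ∷ u′

  -- A simple path of the underlying graph from r to x, listed from x down to r.
  data Up (r : Fin m) : Fin m → List (Fin m) → Set where
    start : Up r r []
    step  : ∀ {x z ρ} → x ∼ z → All (x ≢_) (z ∷ ρ) → Up r z ρ → Up r x (z ∷ ρ)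

  module _ {r : Fin m} where

    Up-linked : ∀ {x ρ} → Up r x ρ → Linked _∼_ (x ∷ ρ)
    Up-linked start        = [-]
    Up-linked (step e _ u) = e ∷ Up-linked u

    Up-unique : ∀ {x ρ} → Up r x ρ → Unique (x ∷ ρ)
    Up-unique start        = [] ∷ []
    Up-unique (step _ a u) = a ∷ Up-unique u

    Up-last : ∀ {x ρ} → Up r x ρ → lastOf x ρ ≡ r
    Up-last start        = refl
    Up-last (step _ _ u) = Up-last u

    Up-cut : ∀ {x y ρ} → x ∈ y ∷ ρ → Up r y ρ → ∃[ σ ] Up r x σ
    Up-cut (here refl) u            = _ , u
    Up-cut (there i)   (step _ _ u) = Up-cut i u

    -- Loop erasure: when `x` already occurs on the path, the path is cut back to that occurrence.
    up : ∀ {x} → Star _∼_ x r → ∃[ ρ ] Up r x ρ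
    up ε = [] , start
    up {x} (_◅_ {j = z} e s) with up s
    ... | ρ , u with x ∈? z ∷ ρ
    ...   | yes i = Up-cut i u
    ...   | no ¬i = z ∷ ρ , step e (All.¬Any⇒All¬ _ ¬i) u

    -- The list runs towards the root, so `opposite` reverses its indices; the edge between `z` and
    -- `x` is then the last one.
    top : DirectedAwayFrom T r → ∀ {x z ρ} → Up r x (z ∷ ρ) → z ⟶ x
    top away {x} {z} {ρ} u =
      subst₂ _⟶_ (cong (lookup xs) (trans (opp-inject (opposite zero)) (cong suc (Fin.opposite-involutive zero))))
        (cong (lookup xs) (cong inject₁ (Fin.opposite-involutive zero)))
        (away v v-root ((λ eq → opp-injective (lookup-injective (Up-unique u) _ _ eq)) , v-linked) (opposite zero))
      where
      xs : List (Fin m)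
      xs = x ∷ z ∷ ρ
      k : ℕ
      k = suc (length ρ)
      v : Fin (suc k) → Fin m
      v i = lookup xs (opposite i)
      v-root : v zero ≡ r
      v-root = trans (lookup-last x (z ∷ ρ)) (Up-last u)
      opp-injective : ∀ {n} {i j : Fin n} → opposite i ≡ opposite j → i ≡ j
      opp-injective {i = i} {j} eq = trans (sym (Fin.opposite-involutive i)) (trans (cong opposite eq) (Fin.opposite-involutive j))
      opp-inject : ∀ {n} (i : Fin n) → opposite (inject₁ i) ≡ suc (opposite i)
      opp-inject {suc n} zero    = refl
      opp-inject {suc n} (suc i) = cong inject₁ (opp-inject i)
      v-linked : ∀ i → v (inject₁ i) ∼ v (suc i)
      v-linked i = subst (_∼ v (suc i)) (cong (lookup xs) (sym (opp-inject i)))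
        (∼-sym (linked-lookup x (z ∷ ρ) (Up-linked u) (opposite i)))

  module OutTree (isTree : IsOutDirectedTree T) where
    open IsOutDirectedTree isTree

    up-to : ∀ x → ∃[ ρ ] Up root x ρ
    up-to x = up (connected x root)

    ⟶-≢ : ∀ {x y} → x ⟶ y → x ≢ y
    ⟶-≢ e refl = loopless _ e

    root-no-parent : ∀ {x} → ¬ x ⟶ root
    root-no-parent e = oriented e (top directedAwayFrom (step (fwd e) (⟶-≢ e ∷ []) start))

    -- Extend the path from the root to x′ first by y and then by x: the edge
    -- x ⟶ y would be traversed backwards, or it closes a cycle.
    parent-unique : ∀ {x x′ y} → x ⟶ y → x′ ⟶ y → x ≡ x′
    parent-unique {x} {x′} {y} e e′ with up-to x′
    ... | ρ , u with y ∈? x′ ∷ ρ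
    parent-unique {x} {x′} {y} e e′ | ρ , u | yes (here refl) = ⊥-elim (loopless _ e′)
    -- If `y` lies on the path to `x′`, it is either the vertex before `x′`, against orientedness,
    -- or the edge `x′ ⟶ y` is a chord.
    parent-unique {x} {x′} {y} e e′ | .(z ∷ ρ) , u@(step {z = z} {ρ} f a w) | yes (there i) with i
    ... | here refl = ⊥-elim (oriented e′ (top directedAwayFrom u))
    ... | there j   = ⊥-elim (no-chord acyclic x′ z ρ (Up-linked u) (Up-unique u) j (bwd e′))
    parent-unique {x} {x′} {y} e e′ | ρ , u | no y∉ with x Fin.≟ x′ | x ∈? ρ
    ... | yes eq  | _     = eq
    ... | no  _   | yes i = ⊥-elim (no-chord acyclic y x′ ρ (Up-linked u′) (Up-unique u′) i (fwd e))
      where u′ = step (bwd e′) (All.¬Any⇒All¬ _ y∉) u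
    ... | no x≢x′ | no ¬i = ⊥-elim (oriented e (top directedAwayFrom
      (step (fwd e) (⟶-≢ e ∷ x≢x′ ∷ All.¬Any⇒All¬ _ ¬i) (step (bwd e′) (All.¬Any⇒All¬ _ y∉) u))))

    child : ∀ x U → All (λ y → ¬ x ⟶ y) U ⊎ (∃[ y ] ∃[ U′ ] x ⟶ y × U ↭ y ∷ U′)
    child x []      = inj₁ []
    child x (y ∷ U) with x ⟶? y | child x U
    ... | yes e | _                     = inj₂ (y , U , e , ↭-refl)
    ... | no _  | inj₂ (z , U′ , e , p) = inj₂ (z , y ∷ U′ , e ,
      ↭-trans (prep y p) (solve 3 (λ a b r → a ⊕ b ⊕ r ⊜ b ⊕ a ⊕ r) ↭-refl (y ∷ []) (z ∷ []) U′))
    ... | no ¬e | inj₁ es               = inj₁ (¬e ∷ es)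

    -- `closed` makes the exploration complete: no vertex left in `rest` has a parent among those
    -- reached.
    record Explored (x : Fin m) (U : List (Fin m)) : Set where
      field
        {subtrees} : List (Tree (Fin m))
        {rest}     : List (Fin m)
        split      : U ↭ labelsF subtrees ++ rest
        isEdge     : All (λ (y , z) → y ⟶ z) (edges x subtrees)
        closed     : All (λ y → All (λ z → ¬ y ⟶ z) rest) (x ∷ labelsF subtrees)

    explore : ∀ fuel x U → length U ≤ fuel → Explored x U
    explore fuel x U l with child x U
    ... | inj₁ none = record { subtrees = [] ; split = ↭-refl ; isEdge = [] ; closed = none ∷ [] }
    explore zero       x U l | inj₂ (y , U′ , e , p) = ⊥-elim (n≮0 (≤-trans (≤-reflexive (sym (↭-length p))) l))
    explore (suc fuel) x U l | inj₂ (y , U′ , e , p) with explore fuel y U′ (s≤s⁻¹ (≤-trans (≤-reflexive (sym (↭-length p))) l))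
    ... | record { subtrees = us ; rest = R ; split = q ; isEdge = ue ; closed = uc }
      with explore fuel x R (≤-trans (≤-trans (m≤n+m (length R) (length (labelsF us)))
             (≤-reflexive (trans (sym (length-++ (labelsF us))) (sym (↭-length q)))))
             (s≤s⁻¹ (≤-trans (≤-reflexive (sym (↭-length p))) l)))
    ...   | record { subtrees = ts ; rest = R′ ; split = q′ ; isEdge = te ; closed = c ∷ cs } = record
      { subtrees = node y us ∷ ts
      ; split    = ↭-trans p (prep y (↭-trans q (↭-trans (++⁺ˡ (labelsF us) q′)
          (solve 3 (λ a b r → a ⊕ b ⊕ r ⊜ (a ⊕ b) ⊕ r) ↭-refl (labelsF us) (labelsF ts) R′))))
      ; isEdge   = e ∷ All.++⁺ ue te
      -- The vertices below `y` were closed against `R`, hence also against the smaller `R′`.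
      ; closed   = c ∷ All.++⁺ (All.map (λ a → All.++⁻ʳ (labelsF ts) (All-resp-↭ q′ a)) uc) cs
      }

    tree : ∃[ ts ] size (node root ts) ≤ m × Unique (labels (node root ts)) × (∀ x → x ∈ labels (node root ts)) ×
           (∀ {x y} → x ⟶ y → (x , y) ∈ edges root ts)
    tree with ∈-∃++ (∈-allFin root)
    ... | xs , ys , eq with explore _ root (xs ++ ys) ≤-refl
    ...   | record { subtrees = ts ; rest = R ; split = q ; isEdge = es ; closed = cs } =
      ts , size≤m , unique , reached , covers
      where
      perm : allFin m ↭ labels (node root ts) ++ R
      perm = ↭-trans (↭-reflexive eq) (↭-trans (shift root xs ys) (prep root q))
      size≤m : size (node root ts) ≤ m
      size≤m = ≤-trans (m≤m+n _ (length R)) (≤-reflexive (trans (sym (length-++ (labels (node root ts))))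
        (trans (sym (↭-length perm)) (length-tabulate id))))
      unique : Unique (labels (node root ts))
      unique = Unique-++⁻ˡ (labels (node root ts)) (Unique-resp-↭ perm (allFin⁺ m))
      -- Induction along the path from the root: an edge that leaves a reached vertex cannot end in
      -- `R`.
      reach : ∀ {x ρ} → Up root x ρ → x ∈ labels (node root ts)
      reach start = here refl
      reach {x} u@(step {z = z} _ _ w) with ∈-++⁻ (labels (node root ts)) (∈-resp-↭ perm (∈-allFin x))
      ... | inj₁ i = i
      ... | inj₂ j = ⊥-elim (All.lookup (All.lookup cs (reach w)) j (top directedAwayFrom u))
      reached : ∀ x → x ∈ labels (node root ts)
      reached x = reach (proj₂ (up-to x))
      covers : ∀ {x y} → x ⟶ y → (x , y) ∈ edges root ts
      covers {x} {y} e with reached y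
      ... | here refl = ⊥-elim (root-no-parent e)
      ... | there i with parent root ts i
      -- The parent of `y` in the rooted tree is a parent in `T`, hence the only one.
      ...   | x′ , j = subst (λ z → (z , y) ∈ edges root ts) (parent-unique (All.lookup es j) e) j

-- Decidability of the arrow relation

-- Predicates must respect ≈ because colourings and copies are functions, which
-- can be enumerated only up to pointwise equality.
Searchable : (A : Set) → Rel A 0ℓ → Set₁
Searchable A _≈_ = ∀ (P : A → Set) → (∀ {x y} → x ≈ y → P x → P y) → (∀ x → Dec (P x)) → Dec (∃ P)

searchFin : ∀ n → Searchable (Fin n) _≡_
searchFin n P _ P? = Fin.any? P?

searchColour : Searchable Colour _≡_
searchColour P _ P? with P? red | P? blue
... | yes p | _     = yes (red , p)
... | no _  | yes p = yes (blue , p)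
... | no ¬p | no ¬q = no λ { (red , p) → ¬p p ; (blue , q) → ¬q q }

Pointwise : ∀ {A : Set} n → Rel A 0ℓ → Rel (Vector A n) 0ℓ
Pointwise n _≈_ f g = ∀ i → f i ≈ g i

searchVector : ∀ {A : Set} {_≈_ : Rel A 0ℓ} → (∀ x → x ≈ x) → Searchable A _≈_ →
               ∀ n → Searchable (Vector A n) (Pointwise n _≈_)
searchVector ≈-refl search zero    P resp P? =
  map′ (λ p → ◂[] , p) (λ (f , p) → resp (λ ()) p) (P? ◂[])
searchVector {_≈_ = _≈_} ≈-refl search (suc n) P resp P? =
  map′ (λ (x , f , p) → x ◂ f , p) (λ (f , p) → f zero , f ∘ suc , resp (λ { zero → ≈-refl _ ; (suc i) → ≈-refl _ }) p)
    (search (λ x → ∃[ f ] P (x ◂ f))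
      (λ e (f , p) → f , resp (λ { zero → e ; (suc i) → ≈-refl _ }) p)
      (λ x → searchVector ≈-refl search n (λ f → P (x ◂ f))
        (λ e → resp (λ { zero → ≈-refl x ; (suc i) → e i })) (λ f → P? (x ◂ f))))

_≟ᶜ_ : ∀ (c d : Colour) → Dec (c ≡ d)
red  ≟ᶜ red  = yes refl
red  ≟ᶜ blue = no λ ()
blue ≟ᶜ red  = no λ ()
blue ≟ᶜ blue = yes refl

copy? : ∀ {N n} c (G : Digraph n) (χ : EdgeColouring N) → Dec (Copy c G χ)
copy? {N} {n} c G χ = searchVector (λ _ → refl) (searchFin N) n _
  (λ {f} {g} e (inj , hom) →
    (λ {x} {y} eq → inj (trans (e x) (trans eq (sym (e y))))) ,
    λ x y xy → subst₂ (λ a b → χ a b ≡ c) (e x) (e y) (hom x y xy))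
  (λ f → map′ (λ h {x} {y} → h x y) (λ h x y → h {x} {y})
           (Fin.all? λ x → Fin.all? λ y → (f x Fin.≟ f y) →-dec (x Fin.≟ y))
    ×-dec Fin.all? λ x → Fin.all? λ y → (x ⟶? y) →-dec (χ (f x) (f y) ≟ᶜ c))
  where open Digraph G

-- The search is for a colouring without copies. If there is none, decidability of copies removes
-- the double negation.
arrows? : ∀ {n₁ n₂} (G₁ : Digraph n₁) (G₂ : Digraph n₂) N → Dec (Arrows G₁ G₂ N)
arrows? G₁ G₂ N with searchVector (λ _ _ → refl) (searchVector (λ _ → refl) searchColour N) N
    (λ χ → ¬ (Copy red G₁ χ ⊎ Copy blue G₂ χ))
    (λ e ¬c c → ¬c (resp e c)) (λ χ → ¬? (copies? χ))
  where
  copies? : ∀ χ → Dec (Copy red G₁ χ ⊎ Copy blue G₂ χ)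
  copies? χ = copy? red G₁ χ ⊎-dec copy? blue G₂ χ
  resp : ∀ {χ χ′ : EdgeColouring N} → (∀ x y → χ x y ≡ χ′ x y) →
         Copy red G₁ χ′ ⊎ Copy blue G₂ χ′ → Copy red G₁ χ ⊎ Copy blue G₂ χ
  resp e (inj₁ (f , inj , h)) = inj₁ (f , inj , λ x y xy → trans (e _ _) (h x y xy))
  resp e (inj₂ (f , inj , h)) = inj₂ (f , inj , λ x y xy → trans (e _ _) (h x y xy))
... | yes (χ , ¬c) = no λ arrows → ¬c (arrows χ)
... | no ¬∃        = yes λ χ → decidable-stable (copy? red G₁ χ ⊎-dec copy? blue G₂ χ) (λ ¬c → ¬∃ (χ , ¬c))

-- `IsRamseyNumber` asks for the minimum itself, so an upper bound has to be turned into the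
-- smallest value that works.
least : ∀ {P : ℕ → Set} → (∀ n → Dec (P n)) → ∀ n → P n → ∃[ k ] (P k × (∀ j → P j → k ≤ j)) × k ≤ n
least P? n p with P? 0
least P? n       p | yes p₀ = 0 , (p₀ , λ _ _ → z≤n) , z≤n
least P? zero    p | no ¬p₀ = ⊥-elim (¬p₀ p)
least P? (suc n) p | no ¬p₀ with least (P? ∘ suc) n p
... | k , (pₖ , min) , k≤n = suc k , (pₖ , λ { zero p₀ → ⊥-elim (¬p₀ p₀) ; (suc j) pⱼ → s≤s (min j pⱼ) }) , s≤s k≤n

-- From lists to copies, and the linear bound

unique-map : ∀ {A B : Set} (f : A → B) {xs x y} → Unique (map f xs) → x ∈ xs → y ∈ xs → f x ≡ f y → x ≡ y
unique-map f u       (here refl) (here refl) _  = refl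
unique-map f (a ∷ _) (here refl) (there j)   eq = ⊥-elim (All.lookup a (∈-map⁺ f j) eq)
unique-map f (a ∷ _) (there i)   (here refl) eq = ⊥-elim (All.lookup a (∈-map⁺ f i) (sym eq))
unique-map f (_ ∷ u) (there i)   (there j)   eq = unique-map f u i j eq

linked-toℕ : ∀ {A : Set} {R : Rel A 0ℓ} xs → Linked R xs →
             ∀ (i j : Fin (length xs)) → suc (toℕ i) ≡ toℕ j → R (lookup xs i) (lookup xs j)
linked-toℕ (x ∷ y ∷ xs) (r ∷ _) zero    (suc zero) _  = r
linked-toℕ (x ∷ y ∷ xs) (_ ∷ l) (suc i) (suc j)    eq = linked-toℕ (y ∷ xs) l i j (suc-injective eq)

module _ {N : ℕ} (χ : EdgeColouring N) where
  open Colouring χ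

  ⊑-unique : ∀ {xs} → xs ⊑ allFin N → Unique xs
  ⊑-unique {xs} (part _ p) = Unique-++⁻ˡ xs (Unique-resp-↭ p (allFin⁺ N))

  path-copy : ∀ {c n} → HasPath c n (allFin N) → Copy c (P⃗ n) χ
  path-copy (P , p , n≤ , s) = (λ i → lookup P (inject≤ i n≤)) ,
    (λ eq → Fin.inject≤-injective n≤ n≤ _ _ (lookup-injective (⊑-unique s) _ _ eq)) ,
    λ i j e → linked-toℕ P p _ _ (trans (cong suc (Fin.toℕ-inject≤ i n≤)) (trans e (sym (Fin.toℕ-inject≤ j n≤))))

  module _ {m : ℕ} (T : Digraph m) where
    open Digraph T
    open Trees χ {Fin m}

    -- The pair `(v , a)` is added for the source only: an edge may start at the root but ends below
    -- it.
    edge-coloured : ∀ {c ts v a es x y} → EmbF c ts a es → (x , y) ∈ edges v ts →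
      ∃[ p ] ∃[ q ] (x , p) ∈ (v , a) ∷ es × (y , q) ∈ es × χ p q ≡ c
    edge-coloured (cons e (node _) _) (here refl) = _ , _ , here refl , here refl , e
    edge-coloured {ts = node u us ∷ _} {v = v} (cons {es = es} {es′} e (node em) em′) (there i) with ∈-++⁻ (edges u us) i
    ... | inj₁ j with edge-coloured {v = u} em j
    ...   | p , q , k , l , e′ = p , q , there (∈-++⁺ˡ k) , there (∈-++⁺ˡ l) , e′
    edge-coloured {ts = node u us ∷ _} {v = v} (cons {es = es} {es′} e (node em) em′) (there i)
        | inj₂ j with edge-coloured {v = v} em′ j
    ...   | p , q , here refl , l , e′ = p , q , here refl , ∈-++⁺ʳ es l , e′
    ...   | p , q , there k   , l , e′ = p , q , there (∈-++⁺ʳ es k) , ∈-++⁺ʳ es l , e′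

    -- `es` is read as the graph of a map: `reached` makes it total, distinct labels make it
    -- single-valued and distinct images make it injective.
    tree-copy : ∀ {c} v ts → Unique (labels (node v ts)) → (∀ x → x ∈ labels (node v ts)) →
                (∀ {x y} → x ⟶ y → (x , y) ∈ edges v ts) → HasTree c (node v ts) (allFin N) → Copy c T χ
    tree-copy {c} v ts unique reached covers (a , es , node emb , s) = f , injective , hom
      where
      labels≡ : map proj₁ es ≡ labels (node v ts)
      labels≡ = emb-labels (node emb)
      image : ∀ x → ∃[ b ] (x , b) ∈ es
      image x with ∈-map⁻ proj₁ (subst (x ∈_) (sym labels≡) (reached x))
      ... | (_ , b) , i , refl = b , i
      f : Fin m → Fin N
      f = proj₁ ∘ image
      f-unique : ∀ {x b} → (x , b) ∈ es → b ≡ f x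
      f-unique {x} i = cong proj₂ (unique-map proj₁ (subst Unique (sym labels≡) unique) i (proj₂ (image x)) refl)
      injective : Injective _≡_ _≡_ f
      injective {x} {y} eq = cong proj₁ (unique-map proj₂ (⊑-unique s) (proj₂ (image x)) (proj₂ (image y)) eq)
      hom : ∀ x y → x ⟶ y → χ (f x) (f y) ≡ c
      hom x y e with edge-coloured emb (covers e)
      ... | p , q , i , j , pq = subst₂ (λ a b → χ a b ≡ c) (f-unique i) (f-unique (there j)) pq

arrows : ∀ n {m} (T : Digraph m) → IsOutDirectedTree T → Arrows (P⃗ n) T (n + 14 * m)
arrows n {m} T isTree χ =
  let ts , size≤m , unique , reached , covers = OutTree.tree T isTree
  in Sum.map (path-copy χ) (tree-copy χ T _ ts unique reached covers)
       (Main.tree-ramsey χ red m (node _ ts) size≤m n (allFin (n + 14 * m)) (≤-reflexive (sym (length-tabulate id))))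

mainTheorem15 : Σ[ c ∈ ℕ ] (∀ (n : ℕ) → 1 ≤ n →
    ∀ (m : ℕ) (T : Digraph m) → IsOutDirectedTree T →
    Σ[ N ∈ ℕ ] (IsRamseyNumber (P⃗ n) T N × N ≤ c * (n + m)))
mainTheorem15 = 14 , λ n _ m T isTree →
  let N , ramsey , N≤ = least (arrows? (P⃗ n) T) (n + 14 * m) (arrows n T isTree)
  in N , ramsey , ≤-trans N≤ (≤-trans (+-monoˡ-≤ (14 * m) (m≤m+n n (13 * n))) (≤-reflexive (sym (*-distribˡ-+ 14 n m))))
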